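{- Let $\Pi$ be an equivalence relation on $\mathbb{N}$ decided by a total recursive $\pi$, and suppose there is a total recursive function $\rho$ with $\rho(x) = 0$ if $|P(x)| = \infty$ and $\rho(x) = |P(x)|$ otherwise, where $P(x)$ is the block of $\Pi$ containing $x$. Then there is a recursive semi-normal permutation whose cycles are exactly the blocks of $\Pi$, and it can be constructed from $\pi$ and $\rho$.
   Context: Let $\delta:\mathbb{Z}\to\mathbb{N}$, $\delta(0)=0$, $\delta(k)=2k$ ($k>0$), $\delta(k)=-2k-1$ ($k<0$). A permutation $f$ of $\mathbb{N}$ is semi-normal if every infinite cycle with least element $a_0$ has $j\mapsto f^{\delta^{ -1}(j)}(a_0)$ strictly increasing for all $j\ge0$, and every finite cycle of length $n$ with least element $a_0$ has $j\mapsto f^j(a_0)$ strictly increasing for $0\le j<n$. Cycles are orbits $\{f^k(x):k\in\mathbb{Z}\}$. -}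

module Defs where

open import Data.Nat using (ℕ; zero; suc; _+_; _*_; _≤_; _<_)
open import Data.Integer using (ℤ; +_; -[1+_])
open import Data.Bool using (Bool; true)
open import Data.List using (List; length)
open import Data.List.Membership.Propositional using (_∈_)
open import Data.List.Relation.Unary.Unique.Propositional using (Unique)
open import Data.Product using (Σ; ∃; _×_; _,_)
open import Data.Sum using (_⊎_)
open import Function.Bundles using (_↔_; Inverse; _⇔_)
open import Function using (_∘_)
open import Relation.Binary.PropositionalEquality using (_≡_)
open import Relation.Binary.Structures using (IsEquivalence)

δ : ℤ → ℕ
δ (+ zero)  = 0
δ (+ suc k) = 2 * suc k
δ -[1+ k ]  = 2 * k + 1          -- -2(-(k+1)) - 1 = 2k+1

iter : (ℕ → ℕ) → ℕ → ℕ → ℕ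
iter f zero    x = x
iter f (suc n) x = f (iter f n x)

pow : ℕ ↔ ℕ → ℤ → ℕ → ℕ
pow f (+ n)      = iter (Inverse.to f) n
pow f -[1+ n ]   = iter (Inverse.from f) (suc n)

Pred : Set₁
Pred = ℕ → Set

HasCard : Pred → ℕ → Set
HasCard P n = Σ (List ℕ) λ xs → Unique xs × length xs ≡ n × (∀ y → (P y ⇔ (y ∈ xs)))

Infinite : Pred → Set
Infinite P = ∀ m → ∃ λ y → m ≤ y × P y

Cycle : ℕ ↔ ℕ → ℕ → Pred
Cycle f x y = ∃ λ (k : ℤ) → pow f k x ≡ y

LeastOfCycle : ℕ ↔ ℕ → ℕ → Set
LeastOfCycle f a₀ = ∀ y → Cycle f a₀ y → a₀ ≤ y

SemiNormal : ℕ ↔ ℕ → Set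
SemiNormal f =
  (∀ a₀ → LeastOfCycle f a₀ → Infinite (Cycle f a₀) →
     ∀ (k l : ℤ) → δ k < δ l → pow f k a₀ < pow f l a₀)
  × (∀ a₀ n → LeastOfCycle f a₀ → HasCard (Cycle f a₀) n →
     ∀ i j → i < j → j < n → iter (Inverse.to f) i a₀ < iter (Inverse.to f) j a₀)

Block : (ℕ → ℕ → Bool) → ℕ → Pred
Block π x y = π x y ≡ true

RhoSpec : (ℕ → ℕ → Bool) → (ℕ → ℕ) → Set
RhoSpec π ρ = ∀ x → (ρ x ≡ 0 × Infinite (Block π x)) ⊎ HasCard (Block π x) (ρ x)

-- List each block of Π in increasing order, the rank of y being the number of
-- elements of its block below y (computable from π).  On an infinite block with
-- least element a the permutation sends the element of rank δ k to the element of
-- rank δ (k + 1); on a finite block of size N it sends the element of rank i to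
-- the element of rank i + 1 mod N.  Hence f^k(a) has rank δ k, resp. f^i(a) has
-- rank i, which is exactly semi-normality, and every block is a single cycle.
-- Gluing the block permutations along the map x ↦ least element of its block
-- yields a permutation of ℕ.

module Submission where

open import Defs
open import Data.Bool using (Bool; true; false; if_then_else_)
open import Data.Empty using (⊥; ⊥-elim)
open import Data.Integer as ℤ using (ℤ; +_; -[1+_]; 1ℤ; -1ℤ; _-_)
import Data.Integer.Properties as ℤ
open import Data.Integer.Tactic.RingSolver using (solve-∀)
open import Data.List using (List; []; _∷_; length; _++_; map; upTo)
open import Data.List.Extrema.Nat using (max; xs≤max)
open import Data.List.Membership.Propositional using (_∈_)
open import Data.List.Membership.Propositional.Properties using (∈-∃++; ∈-++⁻; ∈-++⁺ˡ; ∈-++⁺ʳ; ∈-map⁺; ∈-upTo⁺)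
open import Data.List.Properties using (length-++; length-map; length-upTo)
open import Data.List.Relation.Binary.Subset.Propositional using (_⊆_)
import Data.List.Relation.Unary.All as All
open import Data.List.Relation.Unary.AllPairs using (_∷_)
open import Data.List.Relation.Unary.Any using (here; there)
open import Data.List.Relation.Unary.Unique.Propositional using (Unique)
open import Data.Nat
open import Data.Nat.Properties
open import Data.Product using (Σ; ∃; _×_; _,_; proj₁; proj₂)
open import Data.Sum using (_⊎_; inj₁; inj₂)
open import Data.Unit using (⊤; tt)
open import Function.Bundles using (_↔_; _⇔_; Inverse; Equivalence; mk↔ₛ′; mk⇔)
open import Relation.Binary.PropositionalEquality
open import Relation.Binary.Structures using (IsEquivalence)
open import Relation.Nullary using (yes; no; contradiction)
open import Function using (_∘′_; id)

private
  variable
    i j m n v x y z : ℕ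

iter-+ : ∀ f m n x → iter f (m + n) x ≡ iter f m (iter f n x)
iter-+ f zero    n x = refl
iter-+ f (suc m) n x = cong f (iter-+ f m n x)

module _ {P : ℕ → Set} (g : ℕ → ℕ) (g-closed : ∀ {x} → P x → P (g x)) where

  iter-closed : ∀ n → P x → P (iter g n x)
  iter-closed zero    px = px
  iter-closed (suc n) px = g-closed (iter-closed n px)

  iter-intertwine : (h e : ℕ → ℕ) → (∀ {i} → P i → h (e i) ≡ e (g i)) →
                    ∀ n → P i → iter h n (e i) ≡ e (iter g n i)
  iter-intertwine h e comm zero    pi = refl
  iter-intertwine h e comm (suc n) pi =
    trans (cong h (iter-intertwine h e comm n pi)) (comm (iter-closed n pi))

-- Ranks and enumerations

rank : (ℕ → Bool) → ℕ → ℕ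
rank p zero    = zero
rank p (suc n) = if p n then suc (rank p n) else rank p n

module _ {p : ℕ → Bool} where

  rank-suc-∈ : p y ≡ true → rank p (suc y) ≡ suc (rank p y)
  rank-suc-∈ py rewrite py = refl

  rank-≤-suc : ∀ n → rank p n ≤ rank p (suc n)
  rank-≤-suc n with p n
  ... | true  = n≤1+n _
  ... | false = ≤-refl

  rank-mono : m ≤ n → rank p m ≤ rank p n
  rank-mono {n = zero} z≤n = z≤n
  rank-mono {n = suc n} m≤1+n with m≤n⇒m<n∨m≡n m≤1+n
  ... | inj₁ m<1+n = ≤-trans (rank-mono (s≤s⁻¹ m<1+n)) (rank-≤-suc n)
  ... | inj₂ refl  = ≤-refl

  rank-< : p y ≡ true → y < z → rank p y < rank p z
  rank-< py y<z = ≤-trans (≤-reflexive (sym (rank-suc-∈ py))) (rank-mono y<z)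

  rank-cancel-< : rank p y < rank p z → y < z
  rank-cancel-< {y} {z} r< with y <? z
  ... | yes y<z = y<z
  ... | no y≮z  = contradiction (rank-mono (≮⇒≥ y≮z)) (<⇒≱ r<)

  rank-cancel-≤ : p z ≡ true → rank p y ≤ rank p z → y ≤ z
  rank-cancel-≤ {z} {y} pz r≤ with y ≤? z
  ... | yes y≤z = y≤z
  ... | no y≰z  = contradiction r≤ (<⇒≱ (rank-< pz (≰⇒> y≰z)))

  rank-injective : p y ≡ true → p z ≡ true → rank p y ≡ rank p z → y ≡ z
  rank-injective py pz eq =
    ≤-antisym (rank-cancel-≤ pz (≤-reflexive eq)) (rank-cancel-≤ py (≤-reflexive (sym eq)))

  rank-surjective : j < rank p v → ∃ λ y → p y ≡ true × rank p y ≡ j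
  rank-surjective {j} {suc v} j<r with p v in pv
  ... | false = rank-surjective {v = v} j<r
  ... | true with m≤n⇒m<n∨m≡n (s≤s⁻¹ j<r)
  ...   | inj₁ j<r′ = rank-surjective {v = v} j<r′
  ...   | inj₂ refl = v , pv , refl

  rank-unbounded : Infinite (λ y → p y ≡ true) → ∀ j → ∃ λ v → j < rank p v
  rank-unbounded inf zero with inf 0
  ... | y , _ , py = suc y , ≤-trans (s≤s z≤n) (rank-< py ≤-refl)
  rank-unbounded inf (suc j) with rank-unbounded inf j
  ... | v , j<r with inf v
  ...   | y , v≤y , py = suc y , ≤-trans (s≤s (≤-trans j<r (rank-mono v≤y))) (rank-< py ≤-refl)

rank-cong : {p q : ℕ → Bool} → (∀ w → p w ≡ q w) → ∀ n → rank p n ≡ rank q n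
rank-cong eq zero = refl
rank-cong eq (suc n) rewrite eq n | rank-cong eq n = refl

-- 0 is a junk value, returned when fewer than j + 1 elements below v satisfy p.
select : (ℕ → Bool) → ℕ → ℕ → ℕ
select p v j with j <? rank p v
... | yes j<r = proj₁ (rank-surjective {p = p} {v = v} j<r)
... | no _    = 0

select-spec : ∀ {p} → j < rank p v → p (select p v j) ≡ true × rank p (select p v j) ≡ j
select-spec {j} {v} {p} j<r with j <? rank p v
... | yes j<r′ = proj₂ (rank-surjective {p = p} {v = v} j<r′)
... | no j≮r   = contradiction j<r j≮r

record Enumeration (p : ℕ → Bool) : Set₁ where
  field
    Index     : ℕ → Set
    enum      : ℕ → ℕ
    enum-∈    : Index j → p (enum j) ≡ true
    rank-enum : Index j → rank p (enum j) ≡ j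
    rank-∈    : p y ≡ true → Index (rank p y)

  enum-rank : p y ≡ true → enum (rank p y) ≡ y
  enum-rank py = rank-injective (enum-∈ (rank-∈ py)) py (rank-enum (rank-∈ py))

  enum-< : Index i → Index j → i < j → enum i < enum j
  enum-< ii ij i<j =
    rank-cancel-< {p = p} (subst₂ _<_ (sym (rank-enum ii)) (sym (rank-enum ij)) i<j)

enumeration : ∀ {p} (Index : ℕ → Set) (bound : ℕ → ℕ) →
              (∀ {j} → Index j → j < rank p (bound j)) →
              (∀ {y} → p y ≡ true → Index (rank p y)) → Enumeration p
enumeration {p} Index bound below rank-∈ = record
  { Index     = Index
  ; enum      = λ j → select p (bound j) j
  ; enum-∈    = λ ij → proj₁ (select-spec {v = bound _} {p = p} (below ij))
  ; rank-enum = λ ij → proj₂ (select-spec {v = bound _} {p = p} (below ij))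
  ; rank-∈    = rank-∈
  }

-- Permutations of subsets of ℕ

record PermutationOn (P : ℕ → Set) : Set where
  field
    to          : ℕ → ℕ
    from        : ℕ → ℕ
    to-closed   : P x → P (to x)
    from-closed : P x → P (from x)
    from-to     : P x → from (to x) ≡ x
    to-from     : P x → to (from x) ≡ x

  power : ℤ → ℕ → ℕ
  power (+ n)    = iter to n
  power -[1+ n ] = iter from (suc n)

  power-closed : ∀ k → P x → P (power k x)
  power-closed (+ n)    = iter-closed {P = P} to to-closed n
  power-closed -[1+ n ] = iter-closed {P = P} from from-closed (suc n)

open PermutationOn using (to; from; power)

IsTransitive : {P : ℕ → Set} → PermutationOn P → Set
IsTransitive {P} σ = ∀ {x y} → P x → P y → ∃ λ k → power σ k x ≡ y

power-intertwine : ∀ {P Q} (σ : PermutationOn P) (τ : PermutationOn Q) (e : ℕ → ℕ) →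
  (∀ {i} → P i → to τ (e i) ≡ e (to σ i)) →
  (∀ {i} → P i → from τ (e i) ≡ e (from σ i)) →
  ∀ k → P i → power τ k (e i) ≡ e (power σ k i)
power-intertwine σ τ e to-comm from-comm (+ n) =
  iter-intertwine (to σ) (PermutationOn.to-closed σ) (to τ) e to-comm n
power-intertwine σ τ e to-comm from-comm -[1+ n ] =
  iter-intertwine (from σ) (PermutationOn.from-closed σ) (from τ) e from-comm (suc n)

toInverse : PermutationOn (λ _ → ⊤) → ℕ ↔ ℕ
toInverse σ = mk↔ₛ′ (to σ) (from σ) (λ x → PermutationOn.to-from σ tt) (λ x → PermutationOn.from-to σ tt)

pow-toInverse : ∀ σ k x → pow (toInverse σ) k x ≡ power σ k x
pow-toInverse σ (+ n)    x = refl
pow-toInverse σ -[1+ n ] x = refl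

module _ {p : ℕ → Bool} (E : Enumeration p) where
  open Enumeration E

  conjugate : PermutationOn Index → PermutationOn (λ y → p y ≡ true)
  conjugate σ = record
    { to          = λ y → enum (to σ (rank p y))
    ; from        = λ y → enum (from σ (rank p y))
    ; to-closed   = λ py → enum-∈ (PermutationOn.to-closed σ (rank-∈ py))
    ; from-closed = λ py → enum-∈ (PermutationOn.from-closed σ (rank-∈ py))
    ; from-to     = λ py → inverse (from σ) (PermutationOn.to-closed σ (rank-∈ py)) (PermutationOn.from-to σ (rank-∈ py)) py
    ; to-from     = λ py → inverse (to σ) (PermutationOn.from-closed σ (rank-∈ py)) (PermutationOn.to-from σ (rank-∈ py)) py
    }
    where
    inverse : ∀ {y i} (h : ℕ → ℕ) → Index i → h i ≡ rank p y → p y ≡ true → enum (h (rank p (enum i))) ≡ y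
    inverse {y} h ii hi≡r py = begin
      enum (h (rank p (enum _))) ≡⟨ cong (enum ∘′ h) (rank-enum ii) ⟩
      enum (h _)                 ≡⟨ cong enum hi≡r ⟩
      enum (rank p y)            ≡⟨ enum-rank py ⟩
      y                          ∎
      where open ≡-Reasoning

  power-conjugate : ∀ σ k → Index i → power (conjugate σ) k (enum i) ≡ enum (power σ k i)
  power-conjugate σ = power-intertwine σ (conjugate σ) enum
    (λ ii → cong (enum ∘′ to σ) (rank-enum ii)) (λ ii → cong (enum ∘′ from σ) (rank-enum ii))

  conjugate-transitive : ∀ σ → IsTransitive σ → IsTransitive (conjugate σ)
  conjugate-transitive σ σ-trans {x} {y} px py with σ-trans (rank-∈ px) (rank-∈ py)
  ... | k , σᵏ = k , (begin
    power (conjugate σ) k x                  ≡⟨ cong (power (conjugate σ) k) (sym (enum-rank px)) ⟩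
    power (conjugate σ) k (enum (rank p x))  ≡⟨ power-conjugate σ k (rank-∈ px) ⟩
    enum (power σ k (rank p x))              ≡⟨ cong enum σᵏ ⟩
    enum (rank p y)                          ≡⟨ enum-rank py ⟩
    y                                        ∎)
    where open ≡-Reasoning

-- The two index permutations

awayFromZero : ℤ → ℤ
awayFromZero (+ n)    = + suc n
awayFromZero -[1+ n ] = -[1+ suc n ]

δ⁻¹ : ℕ → ℤ
δ⁻¹ zero          = + 0
δ⁻¹ (suc zero)    = -[1+ 0 ]
δ⁻¹ (suc (suc n)) = awayFromZero (δ⁻¹ n)

δ-awayFromZero : ∀ k → δ (awayFromZero k) ≡ suc (suc (δ k))
δ-awayFromZero (+ zero)  = refl
δ-awayFromZero (+ suc n) = *-suc 2 (suc n)
δ-awayFromZero -[1+ n ]  = cong (_+ 1) (*-suc 2 n)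

δ-δ⁻¹ : ∀ n → δ (δ⁻¹ n) ≡ n
δ-δ⁻¹ zero          = refl
δ-δ⁻¹ (suc zero)    = refl
δ-δ⁻¹ (suc (suc n)) = trans (δ-awayFromZero (δ⁻¹ n)) (cong (suc ∘′ suc) (δ-δ⁻¹ n))

δ⁻¹-δ : ∀ k → δ⁻¹ (δ k) ≡ k
δ⁻¹-δ (+ zero)        = refl
δ⁻¹-δ -[1+ zero ]     = refl
δ⁻¹-δ (+ suc n)       = trans (cong δ⁻¹ (δ-awayFromZero (+ n))) (cong awayFromZero (δ⁻¹-δ (+ n)))
δ⁻¹-δ -[1+ suc n ]    = trans (cong δ⁻¹ (δ-awayFromZero -[1+ n ])) (cong awayFromZero (δ⁻¹-δ -[1+ n ]))

zigzag : PermutationOn (λ _ → ⊤)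
zigzag = record
  { to          = λ i → δ (ℤ.suc (δ⁻¹ i))
  ; from        = λ i → δ (ℤ.pred (δ⁻¹ i))
  ; to-closed   = λ _ → tt
  ; from-closed = λ _ → tt
  ; from-to     = λ {i} _ → cancel ℤ.pred ℤ.suc ℤ.pred-suc i
  ; to-from     = λ {i} _ → cancel ℤ.suc ℤ.pred ℤ.suc-pred i
  }
  where
  cancel : (h h′ : ℤ → ℤ) → (∀ k → h (h′ k) ≡ k) → ∀ i → δ (h (δ⁻¹ (δ (h′ (δ⁻¹ i))))) ≡ i
  cancel h h′ hh′≡id i = begin
    δ (h (δ⁻¹ (δ (h′ (δ⁻¹ i))))) ≡⟨ cong (δ ∘′ h) (δ⁻¹-δ _) ⟩
    δ (h (h′ (δ⁻¹ i)))           ≡⟨ cong δ (hh′≡id _) ⟩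
    δ (δ⁻¹ i)                    ≡⟨ δ-δ⁻¹ i ⟩
    i                            ∎
    where open ≡-Reasoning

power-zigzag : ∀ k l → power zigzag k (δ l) ≡ δ (l ℤ.+ k)
power-zigzag (+ n)    l = iter-suc n
  where
  suc-+ : ∀ (l m : ℤ) → 1ℤ ℤ.+ (l ℤ.+ m) ≡ l ℤ.+ (1ℤ ℤ.+ m)
  suc-+ = solve-∀
  iter-suc : ∀ n → iter (to zigzag) n (δ l) ≡ δ (l ℤ.+ + n)
  iter-suc zero    = cong δ (sym (ℤ.+-identityʳ l))
  iter-suc (suc n) = trans (cong (λ i → δ (ℤ.suc (δ⁻¹ i))) (iter-suc n))
                           (cong δ (trans (cong ℤ.suc (δ⁻¹-δ (l ℤ.+ + n))) (suc-+ l (+ n))))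
power-zigzag -[1+ n ] l = iter-pred (suc n)
  where
  pred-- : ∀ (l m : ℤ) → -1ℤ ℤ.+ (l - m) ≡ l - (1ℤ ℤ.+ m)
  pred-- = solve-∀
  iter-pred : ∀ n → iter (from zigzag) n (δ l) ≡ δ (l - + n)
  iter-pred zero    = cong δ (sym (ℤ.+-identityʳ l))
  iter-pred (suc n) = trans (cong (λ i → δ (ℤ.pred (δ⁻¹ i))) (iter-pred n))
                            (cong δ (trans (cong ℤ.pred (δ⁻¹-δ (l - + n))) (pred-- l (+ n))))

zigzag-transitive : IsTransitive zigzag
zigzag-transitive {i} {j} _ _ = δ⁻¹ j - δ⁻¹ i , (begin
  power zigzag (δ⁻¹ j - δ⁻¹ i) i               ≡⟨ cong (power zigzag (δ⁻¹ j - δ⁻¹ i)) (sym (δ-δ⁻¹ i)) ⟩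
  power zigzag (δ⁻¹ j - δ⁻¹ i) (δ (δ⁻¹ i))     ≡⟨ power-zigzag _ (δ⁻¹ i) ⟩
  δ (δ⁻¹ i ℤ.+ (δ⁻¹ j - δ⁻¹ i))                 ≡⟨ cong δ (+-[-] (δ⁻¹ i) (δ⁻¹ j)) ⟩
  δ (δ⁻¹ j)                                     ≡⟨ δ-δ⁻¹ j ⟩
  j                                             ∎)
  where
  open ≡-Reasoning
  +-[-] : ∀ (l m : ℤ) → l ℤ.+ (m - l) ≡ m
  +-[-] = solve-∀

rotate : ℕ → ℕ → ℕ
rotate N i with suc i <? N
... | yes _ = suc i
... | no _  = 0

rotate⁻¹ : ℕ → ℕ → ℕ
rotate⁻¹ N zero    = pred N
rotate⁻¹ N (suc i) = i

rotate-suc : ∀ {N} → suc i < N → rotate N i ≡ suc i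
rotate-suc {i} {N} 1+i<N with suc i <? N
... | yes _     = refl
... | no 1+i≮N = contradiction 1+i<N 1+i≮N

rotate-last : ∀ {N} → suc i ≡ N → rotate N i ≡ 0
rotate-last {i} {N} 1+i≡N with suc i <? N
... | yes 1+i<N = contradiction 1+i≡N (<⇒≢ 1+i<N)
... | no _      = refl

rotation : ∀ N → PermutationOn (_< N)
rotation N = record
  { to          = rotate N
  ; from        = rotate⁻¹ N
  ; to-closed   = to-closed
  ; from-closed = from-closed
  ; from-to     = from-to
  ; to-from     = to-from
  }
  where
  to-closed : i < N → rotate N i < N
  to-closed {i} i<N with suc i <? N
  ... | yes 1+i<N = 1+i<N
  ... | no _      = ≤-<-trans z≤n i<N

  from-closed : i < N → rotate⁻¹ N i < N
  from-closed {zero}  (s≤s _) = n<1+n _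
  from-closed {suc i} 1+i<N   = <-trans (n<1+n i) 1+i<N

  from-to : i < N → rotate⁻¹ N (rotate N i) ≡ i
  from-to {i} i<N with suc i <? N
  ... | yes _     = refl
  ... | no 1+i≮N = cong pred (≤-antisym (≮⇒≥ 1+i≮N) i<N)

  to-from : i < N → rotate N (rotate⁻¹ N i) ≡ i
  to-from {zero}  (s≤s _) = rotate-last refl
  to-from {suc i} 1+i<N   = rotate-suc 1+i<N

iter-rotate : ∀ {N} t → i + t < N → iter (rotate N) t i ≡ i + t
iter-rotate {i} zero    _     = sym (+-identityʳ i)
iter-rotate {i} {N} (suc t) i+t<N = begin
  rotate N (iter (rotate N) t i) ≡⟨ cong (rotate N) (iter-rotate t (<-trans (+-monoʳ-< i (n<1+n t)) i+t<N)) ⟩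
  rotate N (i + t)              ≡⟨ rotate-suc {N = N} (subst (_< N) (+-suc i t) i+t<N) ⟩
  suc (i + t)                   ≡⟨ +-suc i t ⟨
  i + suc t                     ∎
  where open ≡-Reasoning

rotation-transitive : ∀ N → IsTransitive (rotation N)
rotation-transitive N {i} {j} i<N j<N with m≤n⇒∃[o]m+o≡n i<N
... | o , 1+i+o≡N = + (j + suc o) , (begin
  iter (rotate N) (j + suc o) i             ≡⟨ iter-+ (rotate N) j (suc o) i ⟩
  iter (rotate N) j (iter (rotate N) (suc o) i) ≡⟨ cong (λ x → iter (rotate N) j (rotate N x)) (iter-rotate o (≤-reflexive 1+i+o≡N)) ⟩
  iter (rotate N) j (rotate N (i + o))      ≡⟨ cong (iter (rotate N) j) (rotate-last 1+i+o≡N) ⟩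
  iter (rotate N) j 0                       ≡⟨ iter-rotate j j<N ⟩
  j                                         ∎)
  where open ≡-Reasoning

-- Permutations of a single block

unique-⊆⇒length≤ : {xs ys : List ℕ} → Unique xs → xs ⊆ ys → length xs ≤ length ys
unique-⊆⇒length≤ {[]}     _          _    = z≤n
unique-⊆⇒length≤ {x ∷ xs} (x∉xs ∷ u) x∷xs⊆ys with ∈-∃++ (x∷xs⊆ys (here refl))
... | us , vs , refl = begin
  suc (length xs)             ≤⟨ s≤s (unique-⊆⇒length≤ u xs⊆us++vs) ⟩
  suc (length (us ++ vs))     ≡⟨ cong suc (length-++ us) ⟩
  suc (length us + length vs) ≡⟨ +-suc (length us) (length vs) ⟨
  length us + length (x ∷ vs) ≡⟨ length-++ us ⟨
  length (us ++ x ∷ vs)       ∎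
  where
  open ≤-Reasoning
  xs⊆us++vs : xs ⊆ us ++ vs
  xs⊆us++vs {y} y∈xs with ∈-++⁻ us (x∷xs⊆ys (there y∈xs))
  ... | inj₁ y∈us         = ∈-++⁺ˡ y∈us
  ... | inj₂ (here refl)  = contradiction refl (All.lookup x∉xs y∈xs)
  ... | inj₂ (there y∈vs) = ∈-++⁺ʳ us y∈vs

module _ {P : Pred} (card : HasCard P n) where

  upperBound : ℕ
  upperBound = suc (max 0 (proj₁ card))

  upperBound-> : P y → y < upperBound
  upperBound-> py = s≤s (All.lookup (xs≤max 0 (proj₁ card)) (Equivalence.to (proj₂ (proj₂ (proj₂ card)) _) py))

  finite-not-infinite : {Q : Pred} → Infinite Q → (∀ y → Q y → P y) → ⊥
  finite-not-infinite inf Q⊆P with inf upperBound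
  ... | y , bound≤y , qy = <⇒≱ (upperBound-> (Q⊆P y qy)) bound≤y

module InfiniteBlock {p : ℕ → Bool} (inf : Infinite (λ y → p y ≡ true)) where

  E : Enumeration p
  E = enumeration (λ _ → ⊤) (λ j → proj₁ (rank-unbounded inf j))
        (λ {j} _ → proj₂ (rank-unbounded inf j)) (λ _ → tt)

  open Enumeration E using (enum; enum-rank; enum-<)

  permutation : PermutationOn (λ y → p y ≡ true)
  permutation = conjugate E zigzag

  permutation-transitive : IsTransitive permutation
  permutation-transitive = conjugate-transitive E zigzag zigzag-transitive

  module _ {a} (pa : p a ≡ true) (least : rank p a ≡ 0) where

    orbit : ∀ k → power permutation k a ≡ enum (δ k)
    orbit k = begin
      power permutation k a              ≡⟨ cong (power permutation k) (trans (sym (enum-rank pa)) (cong enum least)) ⟩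
      power permutation k (enum (δ (+ 0))) ≡⟨ power-conjugate E zigzag k tt ⟩
      enum (power zigzag k (δ (+ 0)))    ≡⟨ cong enum (power-zigzag k (+ 0)) ⟩
      enum (δ (+ 0 ℤ.+ k))               ≡⟨ cong (enum ∘′ δ) (ℤ.+-identityˡ k) ⟩
      enum (δ k)                         ∎
      where open ≡-Reasoning

    orbit-increasing : ∀ k l → δ k < δ l → power permutation k a < power permutation l a
    orbit-increasing k l δk<δl = subst₂ _<_ (sym (orbit k)) (sym (orbit l)) (enum-< tt tt δk<δl)

module FiniteBlock {p : ℕ → Bool} (card : HasCard (λ y → p y ≡ true) n) where

  N : ℕ
  N = rank p (upperBound card)

  E : Enumeration p
  E = enumeration (_< N) (λ _ → upperBound card) id (λ py → rank-< py (upperBound-> card py))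

  open Enumeration E using (enum; enum-rank; enum-<; rank-∈)

  permutation : PermutationOn (λ y → p y ≡ true)
  permutation = conjugate E (rotation N)

  permutation-transitive : IsTransitive permutation
  permutation-transitive = conjugate-transitive E (rotation N) (rotation-transitive N)

  module _ {a} (pa : p a ≡ true) (least : rank p a ≡ 0) where

    orbit : ∀ t → t < N → iter (to permutation) t a ≡ enum t
    orbit t t<N = begin
      iter (to permutation) t a          ≡⟨ cong (iter (to permutation) t) (trans (sym (enum-rank pa)) (cong enum least)) ⟩
      iter (to permutation) t (enum 0)   ≡⟨ power-conjugate E (rotation N) (+ t) 0<N ⟩
      enum (iter (rotate N) t 0)         ≡⟨ cong enum (iter-rotate t t<N) ⟩
      enum t                             ∎
      where
      open ≡-Reasoning
      0<N : 0 < N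
      0<N = subst (_< N) least (rank-∈ pa)

    orbit-increasing : i < j → j < N → iter (to permutation) i a < iter (to permutation) j a
    orbit-increasing i<j j<N =
      subst₂ _<_ (sym (orbit _ i<N)) (sym (orbit _ j<N)) (enum-< i<N j<N i<j)
      where i<N = <-trans i<j j<N

  card-≤ : ∀ {Q : Pred} {m} → HasCard Q m → (∀ y → Q y → p y ≡ true) → m ≤ N
  card-≤ (ys , unique , refl , ys≡Q) Q⊆p = begin
    length ys                    ≤⟨ unique-⊆⇒length≤ unique ys⊆enum ⟩
    length (map enum (upTo N))   ≡⟨ length-map enum (upTo N) ⟩
    length (upTo N)              ≡⟨ length-upTo N ⟩
    N                            ∎
    where
    open ≤-Reasoning
    ys⊆enum : ys ⊆ map enum (upTo N)
    ys⊆enum {y} y∈ys = subst (_∈ map enum (upTo N)) (enum-rank py) (∈-map⁺ enum (∈-upTo⁺ (rank-∈ py)))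
      where py = Q⊆p y (Equivalence.from (ys≡Q y) y∈ys)

module _ {p : ℕ → Bool} where

  blockPermutation : Infinite (λ y → p y ≡ true) ⊎ HasCard (λ y → p y ≡ true) m →
                     PermutationOn (λ y → p y ≡ true)
  blockPermutation (inj₁ inf)  = InfiniteBlock.permutation inf
  blockPermutation (inj₂ card) = FiniteBlock.permutation card

  blockPermutation-transitive : ∀ s → IsTransitive (blockPermutation {m = m} s)
  blockPermutation-transitive (inj₁ inf)  = InfiniteBlock.permutation-transitive inf
  blockPermutation-transitive (inj₂ card) = FiniteBlock.permutation-transitive card

  module _ {a} (pa : p a ≡ true) (least : rank p a ≡ 0) {Q : Pred} (Q⊆p : ∀ y → Q y → p y ≡ true) where

    power-blockPermutation-increasing : ∀ s → Infinite Q → ∀ k l → δ k < δ l →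
      power (blockPermutation {m = m} s) k a < power (blockPermutation s) l a
    power-blockPermutation-increasing (inj₁ inf)  _    = InfiniteBlock.orbit-increasing inf pa least
    power-blockPermutation-increasing (inj₂ card) infQ = ⊥-elim (finite-not-infinite card infQ Q⊆p)

    iter-blockPermutation-increasing : ∀ s → (∀ y → p y ≡ true → Q y) → HasCard Q n → i < j → j < n →
      iter (to (blockPermutation {m = m} s)) i a < iter (to (blockPermutation s)) j a
    iter-blockPermutation-increasing (inj₁ inf)  p⊆Q cardQ _   _   = ⊥-elim (finite-not-infinite cardQ inf p⊆Q)
    iter-blockPermutation-increasing (inj₂ card) _   cardQ i<j j<n =
      FiniteBlock.orbit-increasing card pa least i<j (≤-trans j<n (FiniteBlock.card-≤ card cardQ Q⊆p))

-- Gluing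

module Gluing {_≈_ : ℕ → ℕ → Set} (≈-equiv : IsEquivalence _≈_)
              (c : ℕ → ℕ) (c-≈ : ∀ x → c x ≈ x) (c-cong : ∀ {x y} → x ≈ y → c x ≡ c y)
              (perm : ∀ a → PermutationOn (a ≈_)) where

  private module ≈ = IsEquivalence ≈-equiv

  c-idem : ∀ x → c (c x) ≡ c x
  c-idem x = c-cong (c-≈ x)

  c-block : ∀ {a y} → c a ≡ a → a ≈ y → c y ≡ a
  c-block ca a≈y = trans (sym (c-cong a≈y)) ca

  to-agrees : ∀ {a y} → c a ≡ a → a ≈ y → to (perm (c y)) y ≡ to (perm a) y
  to-agrees {y = y} ca a≈y = cong (λ b → to (perm b) y) (c-block ca a≈y)

  from-agrees : ∀ {a y} → c a ≡ a → a ≈ y → from (perm (c y)) y ≡ from (perm a) y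
  from-agrees {y = y} ca a≈y = cong (λ b → from (perm b) y) (c-block ca a≈y)

  glued : PermutationOn (λ _ → ⊤)
  glued = record
    { to          = λ x → to (perm (c x)) x
    ; from        = λ x → from (perm (c x)) x
    ; to-closed   = λ _ → tt
    ; from-closed = λ _ → tt
    ; from-to     = λ {x} _ → trans (from-agrees (c-idem x) (PermutationOn.to-closed (perm (c x)) (c-≈ x)))
                                     (PermutationOn.from-to (perm (c x)) (c-≈ x))
    ; to-from     = λ {x} _ → trans (to-agrees (c-idem x) (PermutationOn.from-closed (perm (c x)) (c-≈ x)))
                                     (PermutationOn.to-from (perm (c x)) (c-≈ x))
    }

  power-glued : ∀ {a y} → c a ≡ a → a ≈ y → ∀ k → power glued k y ≡ power (perm a) k y
  power-glued {a} ca a≈y k = power-intertwine (perm a) glued id (to-agrees ca) (from-agrees ca) k a≈y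

  cycle⇔≈ : (∀ a → IsTransitive (perm a)) → ∀ x y → Cycle (toInverse glued) x y ⇔ x ≈ y
  cycle⇔≈ perm-transitive x y = mk⇔ cycle⇒≈ ≈⇒cycle
    where
    cx≈x = c-≈ x
    cycle⇒≈ : Cycle (toInverse glued) x y → x ≈ y
    cycle⇒≈ (k , refl) = subst (x ≈_) (sym (trans (pow-toInverse glued k x) (power-glued (c-idem x) cx≈x k)))
                           (≈.trans (≈.sym cx≈x) (PermutationOn.power-closed (perm (c x)) k cx≈x))
    ≈⇒cycle : x ≈ y → Cycle (toInverse glued) x y
    ≈⇒cycle x≈y with perm-transitive (c x) cx≈x (≈.trans cx≈x x≈y)
    ... | k , eq = k , trans (pow-toInverse glued k x) (trans (power-glued (c-idem x) cx≈x k) eq)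

module Construction (π : ℕ → ℕ → Bool) (ρ : ℕ → ℕ)
                    (π-equiv : IsEquivalence (Block π)) (spec : RhoSpec π ρ) where

  private module B = IsEquivalence π-equiv

  π-cong : Block π x y → ∀ w → π x w ≡ π y w
  π-cong {x} {y} xy w with π x w in xw | π y w in yw
  ... | true  | true  = refl
  ... | false | false = refl
  ... | true  | false = contradiction (trans (sym (B.trans (B.sym xy) xw)) yw) λ ()
  ... | false | true  = contradiction (trans (sym (B.trans xy yw)) xw) λ ()

  least : ℕ → ℕ
  least x = select (π x) (suc x) 0

  least-spec : ∀ x → Block π x (least x) × rank (π x) (least x) ≡ 0
  least-spec x = select-spec {v = suc x} {p = π x} (≤-<-trans z≤n (rank-< {p = π x} B.refl ≤-refl))

  least-≈ : ∀ x → Block π (least x) x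
  least-≈ x = B.sym (proj₁ (least-spec x))

  least-≤ : ∀ x → least x ≤ x
  least-≤ x = rank-cancel-≤ {p = π x} B.refl (≤-trans (≤-reflexive (proj₂ (least-spec x))) z≤n)

  least-cong : Block π x y → least x ≡ least y
  least-cong {x} {y} xy = rank-injective (proj₁ (least-spec x)) (trans (π-cong xy (least y)) (proj₁ (least-spec y)))
    (trans (proj₂ (least-spec x)) (sym (trans (rank-cong (π-cong xy) (least y)) (proj₂ (least-spec y)))))

  -- The value of ρ itself is never needed, only which case of the specification holds.
  size : ∀ a → Infinite (Block π a) ⊎ HasCard (Block π a) (ρ a)
  size a with spec a
  ... | inj₁ (_ , inf) = inj₁ inf
  ... | inj₂ card      = inj₂ card

  open Gluing π-equiv least least-≈ least-cong (λ a → blockPermutation (size a))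

  permutation : ℕ ↔ ℕ
  permutation = toInverse glued

  cycle⇔block : ∀ x y → Cycle permutation x y ⇔ Block π x y
  cycle⇔block = cycle⇔≈ (λ a → blockPermutation-transitive (size a))

  module _ {a} (a-least : LeastOfCycle permutation a) where

    least-fixed : least a ≡ a
    least-fixed = ≤-antisym (least-≤ a) (a-least (least a) (Equivalence.from (cycle⇔block a (least a)) (B.sym (least-≈ a))))

    rank-least : rank (π a) a ≡ 0
    rank-least = subst (λ z → rank (π a) z ≡ 0) least-fixed (proj₂ (least-spec a))

    cycle⇒block : ∀ y → Cycle permutation a y → Block π a y
    cycle⇒block y = Equivalence.to (cycle⇔block a y)

    power-permutation : ∀ k → pow permutation k a ≡ power (blockPermutation (size a)) k a
    power-permutation k = trans (pow-toInverse glued k a) (power-glued least-fixed B.refl k)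

  semiNormal : SemiNormal permutation
  semiNormal = infinite-cycles , finite-cycles
    where
    infinite-cycles : ∀ a → LeastOfCycle permutation a → Infinite (Cycle permutation a) →
                      ∀ k l → δ k < δ l → pow permutation k a < pow permutation l a
    infinite-cycles a a-least inf k l δk<δl =
      subst₂ _<_ (sym (power-permutation a-least k)) (sym (power-permutation a-least l))
        (power-blockPermutation-increasing B.refl (rank-least a-least) (cycle⇒block a-least) (size a) inf k l δk<δl)

    finite-cycles : ∀ a n → LeastOfCycle permutation a → HasCard (Cycle permutation a) n →
                    ∀ i j → i < j → j < n → iter (Inverse.to permutation) i a < iter (Inverse.to permutation) j a
    finite-cycles a n a-least card i j i<j j<n =
      subst₂ _<_ (sym (power-permutation a-least (+ i))) (sym (power-permutation a-least (+ j)))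
        (iter-blockPermutation-increasing B.refl (rank-least a-least) (cycle⇒block a-least) (size a)
          (λ y → Equivalence.from (cycle⇔block a y)) card i<j j<n)

theorem3p21 : (π : ℕ → ℕ → Bool) → (ρ : ℕ → ℕ) →
    IsEquivalence (λ x y → π x y ≡ true) → RhoSpec π ρ →
    Σ (ℕ ↔ ℕ) λ f → SemiNormal f × (∀ x y → (Cycle f x y ⇔ Block π x y))
theorem3p21 π ρ π-equiv spec = permutation , semiNormal , cycle⇔block
  where open Construction π ρ π-equiv spec
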